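{- For every positive integer $k$ and all sufficiently large $n$ (depending on $k$), $\mu(S_{k,n})\geqslant\mu_a(K_k)+1\geqslant 2^k$.
   Context: Let $G$ be a finite simple graph on the vertex set $\{1,\dots,m\}$ and let $\Gamma$ be a finite set of colors. A strategy for vertex $i$ is a function $F_i:\Gamma^m\to\Gamma$ whose value $F_i(x_1,\dots,x_m)$ depends only on those coordinates $x_j$ for which $j$ is adjacent to $i$ in $G$. For a set $A\subseteq\Gamma^m$ of admissible colorings, a system of strategies $(F_1,\dots,F_m)$ (which may depend on $A$) is winning for $A$ if for every $(x_1,\dots,x_m)\in A$ there is at least one $i$ with $F_i(x_1,\dots,x_m)=x_i$. The hat chromatic number $\mu(G)$ is the largest integer $|\Gamma|$ for which there is a system of strategies winning for $A=\Gamma^m$. The number $\mu_a(G)$ is the largest integer $t$ such that for all $K$, for a color set $\Gamma_K$ of $K$ colors, and for all subsets $A\subseteq\Gamma_K^m$ of cardinality at most $t$, there is a system of strategies winning for $A$. $K_k$ is the complete graph on $k$ vertices. $S_{k,n}$ denotes the $k$-star: the graph obtained by replacing the degree $n$ vertex of the star $K_{1,n}$ by a clique on $k$ vertices, i.e. the graph whose vertex set is a disjoint union $V_1\cup V_2$ with $|V_1|=k$, $|V_2|=n$, $V_1$ inducing a clique, $V_2$ inducing an edgeless graph, and every vertex of $V_1$ adjacent to every vertex of $V_2$. -}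

module Defs where

open import Data.Empty using (⊥)
open import Data.Fin using (Fin; splitAt)
open import Data.Fin.Properties using (_≟_)
open import Data.List using (List; length)
open import Data.List.Membership.Propositional using () renaming (_∈_ to _∈ˡ_)
open import Data.Nat using (ℕ; _+_; _≤_)
open import Data.Nat.Properties using (≤-antisym)
open import Data.Product using (Σ-syntax; ∃-syntax; _×_; _,_)
open import Data.Sum using (_⊎_; inj₁; inj₂)
open import Data.Unit using (⊤; tt)
open import Data.Vec using (Vec; lookup)
open import Level using (Level; 0ℓ)
open import Relation.Binary.Core using (Rel)
open import Relation.Binary.Definitions using (Symmetric; Irreflexive; Decidable)
open import Relation.Binary.PropositionalEquality using (_≡_; _≢_; refl; ≢-sym)
open import Relation.Nullary using (yes; no; ¬?)
open import Relation.Unary using (Pred; _∈_; _⊆_; U)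

private
  variable
    ℓ : Level
    m : ℕ

record Graph (m : ℕ) : Set₁ where
  field
    Adj    : Rel (Fin m) 0ℓ
    symm   : Symmetric Adj
    irrefl : Irreflexive _≡_ Adj
    adj?   : Decidable Adj

complete : ∀ k → Graph k
complete k = record
  { Adj    = _≢_
  ; symm   = ≢-sym
  ; irrefl = λ i≡j i≢j → i≢j i≡j
  ; adj?   = λ i j → ¬? (i ≟ j)
  }

StarAdj : ∀ {k n} → Rel (Fin k ⊎ Fin n) 0ℓ
StarAdj (inj₁ i) (inj₁ j) = i ≢ j
StarAdj (inj₁ _) (inj₂ _) = ⊤
StarAdj (inj₂ _) (inj₁ _) = ⊤
StarAdj (inj₂ _) (inj₂ _) = ⊥

starAdj-sym : ∀ {k n} (u v : Fin k ⊎ Fin n) → StarAdj u v → StarAdj v u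
starAdj-sym (inj₁ _) (inj₁ _) i≢j = ≢-sym i≢j
starAdj-sym (inj₁ _) (inj₂ _) _   = tt
starAdj-sym (inj₂ _) (inj₁ _) _   = tt

starAdj-irrefl : ∀ {k n} (u : Fin k ⊎ Fin n) → StarAdj u u → ⊥
starAdj-irrefl (inj₁ _) i≢i = i≢i refl

starAdj? : ∀ {k n} → Decidable (StarAdj {k} {n})
starAdj? (inj₁ i) (inj₁ j) = ¬? (i ≟ j)
starAdj? (inj₁ _) (inj₂ _) = yes tt
starAdj? (inj₂ _) (inj₁ _) = yes tt
starAdj? (inj₂ _) (inj₂ _) = no λ ()

-- The k-star S_{k,n}: the first k vertices form the clique V₁, the last n
-- vertices form the independent set V₂.
kStar : ∀ k n → Graph (k + n)
kStar k n = record
  { Adj    = λ u v → StarAdj (splitAt k u) (splitAt k v)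
  ; symm   = λ {u} {v} → starAdj-sym (splitAt k u) (splitAt k v)
  ; irrefl = λ { {u} refl → starAdj-irrefl (splitAt k u) }
  ; adj?   = λ u v → starAdj? (splitAt k u) (splitAt k v)
  }

Coloring : ℕ → Set → Set
Coloring m Γ = Vec Γ m

record Strategy (G : Graph m) (Γ : Set) (i : Fin m) : Set where
  open Graph G
  field
    guess : Coloring m Γ → Γ
    local : ∀ x y → (∀ j → Adj i j → lookup x j ≡ lookup y j) → guess x ≡ guess y

open Strategy public

Strategies : Graph m → Set → Set
Strategies {m} G Γ = (i : Fin m) → Strategy G Γ i

Winning : (G : Graph m) {Γ : Set} → Pred (Coloring m Γ) 0ℓ → Strategies G Γ → Set
Winning {m} G A F = ∀ x → x ∈ A → ∃[ i ] guess (F i) x ≡ lookup x i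

-- A has cardinality at most t: its elements all occur in a list of length at
-- most t.  Stated by covering, so that A need not be a decidable subset.
CardAtMost : {X : Set} → Pred X 0ℓ → ℕ → Set
CardAtMost {X} A t = Σ[ xs ∈ List X ] (length xs ≤ t × A ⊆ (_∈ˡ xs))

IsLargest : Pred ℕ ℓ → ℕ → Set ℓ
IsLargest P t = P t × (∀ s → P s → s ≤ t)

IsLargest-unique : (P : Pred ℕ ℓ) → ∀ {s t} → IsLargest P s → IsLargest P t → s ≡ t
IsLargest-unique P (ps , s-max) (pt , t-max) = ≤-antisym (t-max _ ps) (s-max _ pt)

WinnableWith : Graph m → ℕ → Set
WinnableWith G q = Σ[ F ∈ Strategies G (Fin q) ] Winning G U F

WinnableOnAll≤ : Graph m → ℕ → Set₁
WinnableOnAll≤ {m} G t =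
  ∀ K (A : Pred (Coloring m (Fin K)) 0ℓ) → CardAtMost A t →
  Σ[ F ∈ Strategies G (Fin K) ] Winning G A F

-- The invariants μ(G) and μₐ(G) are given as relations (functional, by
-- IsLargest-unique), since the maximum of a predicate on ℕ need not exist.
Isμ : Graph m → ℕ → Set
Isμ G = IsLargest (WinnableWith G)

Isμₐ : Graph m → ℕ → Set₁
Isμₐ G = IsLargest (WinnableOnAll≤ G)

{-# OPTIONS --safe #-}
-- A strategy system wins on a family X of colorings exactly when every member
-- of X can be assigned to a vertex so that two members assigned to the same
-- vertex v which agree on the neighbours of v also agree at v.  For finite
-- families this is decidable; since a family of r colorings can be recolored
-- with r colors, both invariants are maxima of decidable predicates.  They are
-- bounded because a winning assignment s for all colorings with q colors makes
-- x ↦ (s x , x without its coordinate s x) injective, whence q ^ m ≤ m * q ^ (m - 1).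
--
-- With t = μₐ (K_k) and q = t + 1, let the leaves of S_{k,n} play all functions
-- from colorings of the clique to the colors.  Given the colors of the leaves,
-- fewer than q colorings of the clique defeat every leaf: among q distinct ones
-- some leaf's function takes all q values.  The clique, which sees the leaves,
-- wins on these.
--
-- For K_k and fewer than 2 ^ k colorings, slice by the color of one vertex.  At
-- most one slice has 2 ^ (k - 1) elements or more; that vertex guesses its color,
-- and the others win on the remaining slices by induction on k.
module Submission where

open import Defs
open import Data.Fin
  using (Fin; zero; suc; combine; finToFun; funToFin; inject≤; splitAt; _↑ˡ_; _↑ʳ_)
open import Data.Fin.Properties
  using (_≟_; all?; any?; suc-injective; combine-injective; funToFin-finToFin;
    finToFun-funToFin; inject≤-injective; injective⇒≤; splitAt-↑ˡ; splitAt-↑ʳ)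
open import Data.List using (List; []; _∷_; length; map; filter)
import Data.List as List
open import Data.List.Membership.Propositional using () renaming (_∈_ to _∈ˡ_)
open import Data.List.Membership.Propositional.Properties
  using (∈-tabulate⁺; ∈-filter⁺; ∈-filter⁻; ∈-lookup; ∈-map⁺)
open import Data.List.Properties using (length-map; length-tabulate)
import Data.List.Relation.Unary.All as All
open import Data.List.Relation.Unary.AllPairs using (_∷_)
open import Data.List.Relation.Unary.Any using (index)
open import Data.List.Relation.Unary.Any.Properties using (lookup-index)
open import Data.List.Relation.Unary.Unique.Propositional using (Unique)
import Data.List.Relation.Unary.Unique.Propositional.Properties as Unique
open import Data.Nat using (ℕ; zero; suc; _+_; _*_; _^_; _≤_; _<_; _≥_; _≤?_; z≤n; s≤s)
open import Data.Nat.Properties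
  using (≤-refl; ≤-trans; ≤-reflexive; ≤-<-trans; <-irrefl; <⇒≤; ≰⇒>; ≮⇒≥; m≤n⇒m≤1+n;
    m≤n⇒m<n∨m≡n; +-suc; +-comm; +-identityʳ; +-mono-≤; +-cancelʳ-<; *-cancelʳ-≤; m^n≢0;
    suc-pred; allUpTo?)
open import Data.Product using (Σ-syntax; ∃-syntax; _×_; _,_; proj₁; proj₂)
open import Data.Sum using (_⊎_; inj₁; inj₂)
open import Data.Unit using (tt)
open import Data.Vec using (Vec; []; _∷_; head; tail; lookup; tabulate; removeAt; insertAt)
open import Data.Vec.Properties
  using (lookup∘tabulate; tabulate∘lookup; tabulate-cong; removeAt-punchOut; insertAt-removeAt)
open import Function using (_∘_)
open import Function.Definitions using (Injective)
open import Level using (Level; 0ℓ)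
open import Relation.Binary.PropositionalEquality
  using (_≡_; _≢_; _≗_; refl; sym; trans; cong; cong₂; subst; subst₂)
open import Relation.Nullary using (¬_; Dec; yes; no; contradiction; ¬?; map′)
open import Relation.Nullary.Decidable using (_→-dec_; _×-dec_)
open import Relation.Unary using (Pred; _∈_; _⊆_; U; Decidable)

private
  variable
    ℓ : Level
    k m n q r t K : ℕ

-- Codes of colorings, left inverses and maxima.

private
  funToFin-cong : {f g : Fin m → Fin n} → f ≗ g → funToFin f ≡ funToFin g
  funToFin-cong {zero}  f≗g = refl
  funToFin-cong {suc m} f≗g = cong₂ combine (f≗g zero) (funToFin-cong (f≗g ∘ suc))

  decode : Fin (q ^ m) → Coloring m (Fin q)
  decode e = tabulate (finToFun e)

  encode : Coloring m (Fin q) → Fin (q ^ m)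
  encode x = funToFin (lookup x)

  decode-encode : (x : Coloring m (Fin q)) → decode (encode x) ≡ x
  decode-encode x = trans (tabulate-cong (finToFun-funToFin (lookup x))) (tabulate∘lookup x)

  encode-decode : ∀ q m (e : Fin (q ^ m)) → encode {m} {q} (decode {q} {m} e) ≡ e
  encode-decode q m e =
    trans (funToFin-cong (lookup∘tabulate (finToFun {q} {m} e))) (funToFin-finToFin {m} {q} e)

  encode-injective : Injective _≡_ _≡_ (encode {m} {q})
  encode-injective {x = x} {y} eq =
    trans (sym (decode-encode x)) (trans (cong decode eq) (decode-encode y))

  decode-injective : ∀ q m → Injective _≡_ _≡_ (decode {q} {m})
  decode-injective q m {x} {y} eq =
    trans (sym (encode-decode q m x)) (trans (cong encode eq) (encode-decode q m y))

  -- `i₀` serves as the value outside the image of `f`.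
  leftInverse : (f : Fin m → Fin n) → Injective _≡_ _≡_ f → Fin m →
                Σ[ g ∈ (Fin n → Fin m) ] g ∘ f ≗ λ i → i
  leftInverse {m} {n} f f-inj i₀ =
    (λ j → pick j (any? λ i → f i ≟ j)) , λ i → pick-f i (any? λ i′ → f i′ ≟ f i)
    where
    pick : ∀ j → Dec (∃[ i ] f i ≡ j) → Fin m
    pick j (yes (i , _)) = i
    pick j (no _)        = i₀

    pick-f : ∀ i (d : Dec (∃[ i′ ] f i′ ≡ f i)) → pick (f i) d ≡ i
    pick-f i (yes (_ , eq)) = f-inj eq
    pick-f i (no ∄i)        = contradiction (i , refl) ∄i

  -- Downward search from the bound `B`; the witness `s` settles the case where the search reaches
  -- `zero`.
  largest : {P : Pred ℕ ℓ} → Decidable P → ∀ {s} B → P s → (∀ n → P n → n ≤ B) →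
            ∃[ t ] IsLargest P t × s ≤ t
  largest P? {s} zero Ps bound with bound s Ps
  ... | z≤n = zero , (Ps , bound) , z≤n
  largest {P = P} P? {s} (suc B) Ps bound with P? (suc B)
  ... | yes PB = suc B , (PB , bound) , bound s Ps
  ... | no ¬PB = largest P? B Ps bound′
    where
    bound′ : ∀ n → P n → n ≤ B
    bound′ n Pn with m≤n⇒m<n∨m≡n (bound n Pn)
    ... | inj₁ (s≤s n≤B) = n≤B
    ... | inj₂ refl      = contradiction Pn ¬PB

-- Winning systems as assignments of colorings to vertices.

WinnableOn : Graph m → Pred (Coloring m (Fin K)) 0ℓ → Set
WinnableOn {K = K} G A = Σ[ F ∈ Strategies G (Fin K) ] Winning G A F

Agree : Graph m → Fin m → Coloring m (Fin K) → Coloring m (Fin K) → Set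
Agree G i x y = ∀ j → Graph.Adj G i j → lookup x j ≡ lookup y j

Consistent : Graph m → (Fin t → Coloring m (Fin K)) → (Fin t → Fin m) → Set
Consistent G X s =
  ∀ a b → s a ≡ s b → Agree G (s a) (X a) (X b) → lookup (X a) (s a) ≡ lookup (X b) (s a)

Assignable : Graph m → (Fin t → Coloring m (Fin K)) → Set
Assignable G X = ∃[ s ] Consistent G X s

module _ (G : Graph m) where
  open Graph G

  agree? : ∀ i (x y : Coloring m (Fin K)) → Dec (Agree G i x y)
  agree? i x y = all? λ j → adj? i j →-dec (lookup x j ≟ lookup y j)

  consistent? : (X : Fin t → Coloring m (Fin K)) → Decidable (Consistent G X)
  consistent? X s = all? λ a → all? λ b →
    (s a ≟ s b) →-dec (agree? (s a) (X a) (X b) →-dec (lookup (X a) (s a) ≟ lookup (X b) (s a)))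

  Consistent-resp : (X Y : Fin t → Coloring m (Fin K)) {s s′ : Fin t → Fin m} →
                    X ≗ Y → s ≗ s′ → Consistent G X s → Consistent G Y s′
  Consistent-resp _ _ X≗Y s≗s′ cons a b with cons a b
  ... | c rewrite X≗Y a | X≗Y b | s≗s′ a | s≗s′ b = c

  assignable? : (X : Fin t → Coloring m (Fin K)) → Dec (Assignable G X)
  assignable? {t} X = map′
    (λ (e , cons) → finToFun e , cons)
    (λ (s , cons) → funToFin s , Consistent-resp X X (λ _ → refl) (sym ∘ finToFun-funToFin s) cons)
    (any? {m ^ t} λ e → consistent? X (finToFun e))

  private
    -- A color constant in its argument, which only witnesses that there is a color.
    default : Fin K → Fin K
    default {suc K} _ = zero

    default-const : (c d : Fin K) → default c ≡ default d
    default-const {suc K} _ _ = refl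

  defaultStrategies : Strategies G (Fin K)
  defaultStrategies i = record
    { guess = λ x → default (lookup x i)
    ; local = λ x y _ → default-const (lookup x i) (lookup y i)
    }

  -- Vertex `i` looks for a member assigned to `i` that matches `x` on the neighbours, and guesses
  -- its color at `i`. Consistency makes the guess independent of the member found, which gives both
  -- locality and correctness.
  assignable⇒winnable : (X : Fin t → Coloring m (Fin K)) {A : Pred (Coloring m (Fin K)) 0ℓ} →
                        (∀ {x} → x ∈ A → ∃[ a ] X a ≡ x) → Assignable G X → WinnableOn G A
  assignable⇒winnable {t} {K} X {A} A⊆X (s , cons) = F , wins
    where
    Candidate : Fin m → Coloring m (Fin K) → Fin t → Set
    Candidate i x a = s a ≡ i × Agree G i (X a) x

    candidate? : ∀ i x → Dec (∃[ a ] Candidate i x a)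
    candidate? i x = any? λ a → (s a ≟ i) ×-dec agree? i (X a) x

    answer : ∀ i x → Dec (∃[ a ] Candidate i x a) → Fin K
    answer i x (yes (a , _)) = lookup (X a) i
    answer i x (no _)        = default (lookup x i)

    answer-local : ∀ i x y → Agree G i x y → ∀ d e → answer i x d ≡ answer i y e
    answer-local i x y x~y (yes (a , refl , a~x)) (yes (b , sb≡i , b~y)) =
      cons a b (sym sb≡i) λ j adj → trans (a~x j adj) (trans (x~y j adj) (sym (b~y j adj)))
    answer-local i x y x~y (yes (a , sa≡i , a~x)) (no ∄b) =
      contradiction (a , sa≡i , λ j adj → trans (a~x j adj) (x~y j adj)) ∄b
    answer-local i x y x~y (no ∄a) (yes (b , sb≡i , b~y)) =
      contradiction (b , sb≡i , λ j adj → trans (b~y j adj) (sym (x~y j adj))) ∄a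
    answer-local i x y x~y (no _) (no _) = default-const (lookup x i) (lookup y i)

    F : Strategies G (Fin K)
    F i = record
      { guess = λ x → answer i x (candidate? i x)
      ; local = λ x y x~y → answer-local i x y x~y (candidate? i x) (candidate? i y)
      }

    answer-correct : ∀ a d → answer (s a) (X a) d ≡ lookup (X a) (s a)
    answer-correct a (yes (b , sb≡sa , b~a)) =
      sym (cons a b (sym sb≡sa) λ j adj → sym (b~a j adj))
    answer-correct a (no ∄b) = contradiction (a , refl , λ _ _ → refl) ∄b

    wins : Winning G A F
    wins x x∈A with A⊆X x∈A
    ... | a , refl = s a , answer-correct a (candidate? (s a) (X a))

  -- Each member goes to a vertex that guesses it right. Locality gives equal guesses, hence equal
  -- colors, on members that agree around that vertex.
  winnable⇒assignable : (X : Fin t → Coloring m (Fin K)) {A : Pred (Coloring m (Fin K)) 0ℓ} →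
                        (∀ a → X a ∈ A) → WinnableOn G A → Assignable G X
  winnable⇒assignable X X⊆A (F , wins) = winner , cons
    where
    winner : Fin _ → Fin m
    winner a = proj₁ (wins (X a) (X⊆A a))

    correct : ∀ a → guess (F (winner a)) (X a) ≡ lookup (X a) (winner a)
    correct a = proj₂ (wins (X a) (X⊆A a))

    cons : Consistent G X winner
    cons a b wa≡wb a~b = trans (sym (correct a)) (trans (local (F (winner a)) (X a) (X b) a~b)
      (subst (λ i → guess (F i) (X b) ≡ lookup (X b) i) (sym wa≡wb) (correct b)))

  winnableWith⇒assignable : WinnableWith G q → Assignable G (decode {q} {m})
  winnableWith⇒assignable {q} = winnable⇒assignable (decode {q} {m}) {A = U} (λ _ → tt)

  winnableWith? : Decidable (WinnableWith G)
  winnableWith? q = map′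
    (assignable⇒winnable (decode {q} {m}) (λ {x} _ → encode x , decode-encode x))
    winnableWith⇒assignable
    (assignable? (decode {q} {m}))

-- Removing a coordinate, and the bound on the number of colors.

private
  removeAt-lookup : (x y : Vec (Fin q) (suc m)) {i : Fin (suc m)} → removeAt x i ≡ removeAt y i →
                    ∀ {j} → i ≢ j → lookup x j ≡ lookup y j
  removeAt-lookup x y eq i≢j = trans (sym (removeAt-punchOut x i≢j))
    (trans (cong (λ v → lookup v _) eq) (removeAt-punchOut y i≢j))

  removeAt-injective : (x y : Vec (Fin q) (suc m)) {i : Fin (suc m)} → removeAt x i ≡ removeAt y i →
                       lookup x i ≡ lookup y i → x ≡ y
  removeAt-injective x y {i} rest here = trans (sym (insertAt-removeAt x i))
    (trans (cong₂ (λ v c → insertAt v i c) rest here) (insertAt-removeAt y i))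

winnableWith⇒≤ : (G : Graph m) → WinnableWith G q → q ≤ m
winnableWith⇒≤ {m} {zero} G _ = z≤n
winnableWith⇒≤ {zero} {suc q} G (F , wins) with wins [] _
... | () , _
winnableWith⇒≤ {suc m} {q@(suc _)} G win =
  -- The injection `f` gives `q * q ^ m ≤ suc m * q ^ m`.
  *-cancelʳ-≤ q (suc m) (q ^ m) {{m^n≢0 q m}} (injective⇒≤ f-injective)
  where
  s    = proj₁ (winnableWith⇒assignable G win)
  cons = proj₂ (winnableWith⇒assignable G win)

  x : Fin (q ^ suc m) → Coloring (suc m) (Fin q)
  x = decode {q} {suc m}

  f : Fin (q ^ suc m) → Fin (suc m * q ^ m)
  f e = combine (s e) (encode (removeAt (x e) (s e)))

  f-injective : Injective _≡_ _≡_ f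
  f-injective {a} {b} eq with combine-injective (s a) _ (s b) _ eq
  -- No vertex is its own neighbour, so equality off `s a` already gives agreement on the neighbours
  -- of `s a`; consistency then supplies the removed coordinate.
  ... | sa≡sb , ra≡rb = decode-injective q (suc m) (removeAt-injective (x a) (x b) {s a} same-rest
      (cons a b sa≡sb λ j adj → removeAt-lookup (x a) (x b) {s a} same-rest
        λ sa≡j → Graph.irrefl G sa≡j adj))
    where
    same-rest : removeAt (x a) (s a) ≡ removeAt (x b) (s a)
    same-rest = trans (encode-injective ra≡rb) (cong (removeAt (x b)) (sym sa≡sb))

-- Recoloring and decidability for `μₐ`.

private
  -- Replaces each value of f by an index at which f takes it.
  canonical : (Fin r → Fin K) → Fin r → Fin r
  canonical {r} {K} f a = pick (f a) (any? λ b → f b ≟ f a)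
    where
    pick : ∀ c → Dec (∃[ b ] f b ≡ c) → Fin r
    pick c (yes (b , _)) = b
    pick c (no _)        = a

  canonical-section : (f : Fin r → Fin K) → f ∘ canonical f ≗ f
  canonical-section f a with any? (λ b → f b ≟ f a)
  ... | yes (_ , fb≡fa) = fb≡fa
  ... | no _            = refl

  -- The search depends only on the value of `f`, and it cannot fail on a value that `f` takes.
  canonical-cong : (f : Fin r → Fin K) {a b : Fin r} → f a ≡ f b → canonical f a ≡ canonical f b
  canonical-cong f {a} {b} fa≡fb rewrite fa≡fb with any? (λ c → f c ≟ f b)
  ... | yes _ = refl
  ... | no ∄c = contradiction (b , refl) ∄c

  recolor : (Fin r → Coloring m (Fin K)) → Fin r → Coloring m (Fin r)
  recolor X a = tabulate λ i → canonical (λ b → lookup (X b) i) a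

  module _ (X : Fin r → Coloring m (Fin K)) {a b : Fin r} {i : Fin m} where
    recolor-reflects : lookup (recolor X a) i ≡ lookup (recolor X b) i →
                       lookup (X a) i ≡ lookup (X b) i
    recolor-reflects eq = trans (sym (canonical-section f a)) (trans (cong f eq′) (canonical-section f b))
      where
      f : Fin r → Fin K
      f c = lookup (X c) i

      eq′ : canonical f a ≡ canonical f b
      eq′ = trans (sym (lookup∘tabulate _ i)) (trans eq (lookup∘tabulate _ i))

    recolor-preserves : lookup (X a) i ≡ lookup (X b) i →
                        lookup (recolor X a) i ≡ lookup (recolor X b) i
    recolor-preserves eq = trans (lookup∘tabulate _ i)
      (trans (canonical-cong (λ c → lookup (X c) i) eq) (sym (lookup∘tabulate _ i)))

-- Consistency speaks only of equalities between colors of two members at one vertex; recoloring,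
-- done at each vertex separately, preserves and reflects these.
recolor-assignable : (G : Graph m) (X : Fin r → Coloring m (Fin K)) →
                     Assignable G (recolor X) → Assignable G X
recolor-assignable G X (s , cons) = s , λ a b sa≡sb a~b →
  recolor-reflects X {a} {b} (cons a b sa≡sb λ j adj → recolor-preserves X {a} {b} (a~b j adj))

module _ (G : Graph m) where

  AllAssignable : ℕ → Set
  AllAssignable r = (X : Fin r → Coloring m (Fin r)) → Assignable G X

  allAssignable? : Decidable AllAssignable
  allAssignable? r = map′
    (λ all X → transport X (all (funToFin (encode ∘ X))))
    (λ all e → all (family e))
    (all? λ e → assignable? G (family e))
    where
    family : Fin ((r ^ m) ^ r) → Fin r → Coloring m (Fin r)
    family e = decode ∘ finToFun e

    family-funToFin : ∀ X → family (funToFin (encode ∘ X)) ≗ X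
    family-funToFin X a =
      trans (cong decode (finToFun-funToFin (encode ∘ X) a)) (decode-encode (X a))

    -- Decoding the code of `X` returns `X` only pointwise, so the assignment has to be carried
    -- over.
    transport : ∀ X → Assignable G (family (funToFin (encode ∘ X))) → Assignable G X
    transport X (s , cons) = s , Consistent-resp G (family _) X (family-funToFin X) (λ _ → refl) cons

  -- A covering list of length `r ≤ t` is a family that can be recolored with `r` colors, which
  -- removes the quantifiers over `K` and `A`. Conversely, the image of a family of `r` colorings is
  -- an admissible `A`.
  winnableOnAll≤? : Decidable (WinnableOnAll≤ G)
  winnableOnAll≤? t = map′ to from (allUpTo? allAssignable? (suc t))
    where
    to : (∀ {r} → r < suc t → AllAssignable r) → WinnableOnAll≤ G t
    to all K A (xs , len , A⊆xs) = assignable⇒winnable G (List.lookup xs)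
      (λ x∈A → index (A⊆xs x∈A) , sym (lookup-index (A⊆xs x∈A)))
      (recolor-assignable G (List.lookup xs) (all (s≤s len) (recolor (List.lookup xs))))

    from : WinnableOnAll≤ G t → ∀ {r} → r < suc t → AllAssignable r
    from win {r} (s≤s r≤t) X = winnable⇒assignable G X {A = λ x → ∃[ a ] X a ≡ x} (λ a → a , refl)
      (win r _ (List.tabulate X , ≤-trans (≤-reflexive (length-tabulate X)) r≤t ,
                λ { (a , refl) → ∈-tabulate⁺ a }))

  -- With `suc m` colors there are `suc m ^ m` colorings in all; winning on all of them would
  -- contradict `winnableWith⇒≤`.
  winnableOnAll≤⇒< : WinnableOnAll≤ G t → t < suc m ^ m
  winnableOnAll≤⇒< {t} win = ≰⇒> λ all≤t → <-irrefl refl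
    (winnableWith⇒≤ G (win (suc m) U (List.tabulate all ,
      ≤-trans (≤-reflexive (length-tabulate all)) all≤t ,
      λ {x} _ → subst (_∈ˡ List.tabulate all) (decode-encode x) (∈-tabulate⁺ (encode x)))))
    where
    all : Fin (suc m ^ m) → Coloring m (Fin (suc m))
    all = decode

-- Few colorings of a complete graph.

private
  length-filter-disjoint : {X : Set} {P Q : Pred X 0ℓ} (P? : Decidable P) (Q? : Decidable Q) →
    (∀ {x} → P x → ¬ Q x) → ∀ xs → length (filter P? xs) + length (filter Q? xs) ≤ length xs
  length-filter-disjoint P? Q? disj [] = z≤n
  length-filter-disjoint P? Q? disj (x ∷ xs) with P? x | Q? x | length-filter-disjoint P? Q? disj xs
  ... | yes p | yes q | ih = contradiction q (disj p)
  ... | yes _ | no _  | ih = s≤s ih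
  ... | no _  | yes _ | ih = ≤-trans (≤-reflexive (+-suc _ _)) (s≤s ih)
  ... | no _  | no _  | ih = m≤n⇒m≤1+n ih

  module _ (xs : List (Coloring (suc k) (Fin K))) where
    withHead : Fin K → List (Coloring (suc k) (Fin K))
    withHead c = filter (λ x → head x ≟ c) xs

    -- Two disjoint slices of length at least `h` would not fit into `xs`. If no slice is that
    -- large, any color will do, and `d` is taken.
    oneLargeSlice : Fin K → ∀ h → length xs < h + h → ∃[ c₀ ] ∀ c → c ≢ c₀ → length (withHead c) < h
    oneLargeSlice d h len with any? (λ c → h ≤? length (withHead c))
    ... | no ∄c = d , λ c _ → ≰⇒> λ h≤ → ∄c (c , h≤)
    ... | yes (c₀ , large) = c₀ , λ c c≢c₀ → +-cancelʳ-< h _ _ (≤-<-trans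
          (≤-trans (+-mono-≤ ≤-refl large)
            (length-filter-disjoint _ _ (λ { refl → c≢c₀ }) xs)) len)

complete-winnable : ∀ k → t < 2 ^ k → WinnableOnAll≤ (complete k) t
complete-winnable zero (s≤s z≤n) K A ([] , _ , A⊆xs) = (λ ()) , λ x x∈A → contradiction (A⊆xs x∈A) λ ()
complete-winnable (suc k) t<2^k zero A _ = defaultStrategies _ , λ { (() ∷ _) }
complete-winnable (suc k) t<2^k K@(suc _) A (xs , len , A⊆xs) = F , wins
  where
  pivot : ∃[ c₀ ] ∀ c → c ≢ c₀ → length (withHead xs c) < 2 ^ k
  -- `2 ^ suc k` unfolds to `2 ^ k + (2 ^ k + 0)`.
  pivot = oneLargeSlice xs zero (2 ^ k)
    (≤-<-trans len (subst (λ h → _ < 2 ^ k + h) (+-identityʳ (2 ^ k)) t<2^k))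

  c₀ : Fin K
  c₀ = proj₁ pivot

  slice : Fin K → Pred (Coloring k (Fin K)) 0ℓ
  slice c v = A (c ∷ v)

  slice-winnable : ∀ c → c ≢ c₀ → WinnableOn (complete k) (slice c)
  slice-winnable c c≢c₀ = complete-winnable k (proj₂ pivot c c≢c₀) K (slice c)
    ( map tail (withHead xs c) , ≤-reflexive (length-map tail (withHead xs c))
    , λ v∈ → ∈-map⁺ tail (∈-filter⁺ (λ x → head x ≟ c) (A⊆xs v∈) refl))

  F′-dec : ∀ c → Dec (c ≡ c₀) → Strategies (complete k) (Fin K)
  -- On the slice of `c₀` any strategies do, since vertex `zero` is right there.
  F′-dec c (yes _)   = defaultStrategies _
  F′-dec c (no c≢c₀) = proj₁ (slice-winnable c c≢c₀)

  F′ : Fin K → Strategies (complete k) (Fin K)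
  F′ c = F′-dec c (c ≟ c₀)

  F : Strategies (complete (suc k)) (Fin K)
  F zero    = record { guess = λ _ → c₀ ; local = λ _ _ _ → refl }
  F (suc i) = record
    { guess = λ { (c ∷ v) → guess (F′ c i) v }
    -- The other vertices all see vertex `zero`, so they may choose their system by its color.
    ; local = λ { (c ∷ v) (d ∷ w) x~y →
        local-suc v w (x~y zero λ ()) λ j i≢j → x~y (suc j) (i≢j ∘ suc-injective) }
    }
    where
    local-suc : ∀ {c d} v w → c ≡ d → (∀ j → i ≢ j → lookup v j ≡ lookup w j) →
                guess (F′ c i) v ≡ guess (F′ d i) w
    local-suc {c} v w refl v~w = local (F′ c i) v w v~w

  wins-dec : ∀ c v → slice c v → (d : Dec (c ≡ c₀)) →
             c₀ ≡ c ⊎ ∃[ i ] guess (F′-dec c d i) v ≡ lookup v i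
  wins-dec c v v∈ (yes c≡c₀) = inj₁ (sym c≡c₀)
  wins-dec c v v∈ (no c≢c₀)  = inj₂ (proj₂ (slice-winnable c c≢c₀) v v∈)

  wins : Winning (complete (suc k)) A F
  wins (c ∷ v) x∈A with wins-dec c v x∈A (c ≟ c₀)
  ... | inj₁ c₀≡c     = zero , c₀≡c
  ... | inj₂ (i , eq) = suc i , eq

-- Leaves and clique of the k-star.

private
  lookup-injective : {X : Set} {xs : List X} → Unique xs → Injective _≡_ _≡_ (List.lookup xs)
  lookup-injective (x∉xs ∷ _) {zero}  {zero}  eq = refl
  lookup-injective {xs = _ ∷ xs} (x∉xs ∷ _) {zero}  {suc j} eq =
    contradiction eq (All.lookup x∉xs (∈-lookup {xs = xs} j))
  lookup-injective {xs = _ ∷ xs} (x∉xs ∷ _) {suc i} {zero}  eq =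
    contradiction (sym eq) (All.lookup x∉xs (∈-lookup {xs = xs} i))
  lookup-injective (_ ∷ u) {suc i} {suc j} eq = cong suc (lookup-injective u eq)

-- Filtering the enumeration of all colorings lists `A` without repetition; if the list were longer
-- than `t`, its first `suc t` entries would form an injective family.
cardAtMost : {A : Pred (Coloring m (Fin q)) 0ℓ} → Decidable A →
             ¬ (Σ[ f ∈ (Fin (suc t) → Coloring m (Fin q)) ] Injective _≡_ _≡_ f × (∀ l → f l ∈ A)) →
             CardAtMost A t
cardAtMost {m} {q} {t} {A} A? no-injection = xs , xs≤t , A⊆xs
  where
  colorings xs : List (Coloring m (Fin q))
  colorings = List.tabulate (decode {q} {m})
  xs        = filter A? colorings

  xs-unique : Unique xs
  xs-unique = Unique.filter⁺ A? (Unique.tabulate⁺ (decode-injective q m))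

  xs≤t : length xs ≤ t
  xs≤t = ≮⇒≥ λ t<len → no-injection
    ( (λ l → List.lookup xs (inject≤ l t<len))
    , (λ eq → inject≤-injective t<len t<len _ _ (lookup-injective xs-unique eq))
    , (λ l → proj₂ (∈-filter⁻ A? {xs = colorings} (∈-lookup {xs = xs} (inject≤ l t<len)))) )

  A⊆xs : A ⊆ (_∈ˡ xs)
  A⊆xs {x} x∈A = ∈-filter⁺ A?
    (subst (_∈ˡ colorings) (decode-encode x) (∈-tabulate⁺ (encode x))) x∈A

module _ {k t n : ℕ} (win : WinnableOnAll≤ (complete k) t) (n≥N : suc t ^ (suc t ^ k) ≤ n) where

  private
    Q N : ℕ
    Q = suc t
    N = Q ^ (Q ^ k)

    -- `N` counts the functions from clique colorings to colors. The first `N` leaves play each of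
    -- them once; any further leaf plays the constant `zero`.
    leafFunction-retraction : Σ[ h ∈ (Fin n → Fin N) ] h ∘ (λ e → inject≤ e n≥N) ≗ λ e → e
    leafFunction-retraction = leftInverse (λ e → inject≤ e n≥N)
      (λ {e} {e′} → inject≤-injective n≥N n≥N e e′) (funToFin {Q ^ k} {Q} λ _ → zero)

    leafGuess : Fin n → Coloring k (Fin Q) → Fin Q
    leafGuess j c = finToFun (proj₁ leafFunction-retraction j) (encode c)

    leafGuess-surjective : (h : Fin (Q ^ k) → Fin Q) → ∃[ j ] ∀ c → leafGuess j c ≡ h (encode c)
    leafGuess-surjective h = inject≤ (funToFin h) n≥N , λ c → trans
      (cong (λ e → finToFun e (encode c)) (proj₂ leafFunction-retraction (funToFin h)))
      (finToFun-funToFin h (encode c))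

    LeavesLose : Vec (Fin Q) n → Pred (Coloring k (Fin Q)) 0ℓ
    LeavesLose y c = ∀ j → leafGuess j c ≢ lookup y j

    leavesLose-small : ∀ y → CardAtMost (LeavesLose y) t
    leavesLose-small y = cardAtMost (λ c → all? λ j → ¬? (leafGuess j c ≟ lookup y j)) no-injection
      where
      no-injection : ¬ (Σ[ f ∈ (Fin Q → Coloring k (Fin Q)) ] Injective _≡_ _≡_ f × (∀ l → f l ∈ LeavesLose y))
      no-injection (f , f-inj , lose) =
        let h , h-left = leftInverse (encode ∘ f) (f-inj ∘ encode-injective) zero
            j , j-h    = leafGuess-surjective h
            l          = lookup y j
        -- The function `h` sends the code of `f l` to `l` for every `l`. The actual color of leaf
        -- `j` is one of these `l`, so leaf `j` is right on that `f l`.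
        in lose l j (trans (j-h (f l)) (h-left l))

    clique : ∀ y → WinnableOn (complete k) (LeavesLose y)
    clique y = win Q (LeavesLose y) (leavesLose-small y)

    cliqueColors : Coloring (k + n) (Fin Q) → Coloring k (Fin Q)
    cliqueColors x = tabulate λ i → lookup x (i ↑ˡ n)

    leafColors : Coloring (k + n) (Fin Q) → Coloring n (Fin Q)
    leafColors x = tabulate λ j → lookup x (k ↑ʳ j)

    guessAt : Fin k ⊎ Fin n → Coloring (k + n) (Fin Q) → Fin Q
    guessAt (inj₁ i) x = guess (proj₁ (clique (leafColors x)) i) (cliqueColors x)
    guessAt (inj₂ j) x = leafGuess j (cliqueColors x)

    -- The clique's system is chosen from the leaf colors, which every clique vertex sees in full.
    clique-local : ∀ i {y y′ c c′} → y ≡ y′ → (∀ j → i ≢ j → lookup c j ≡ lookup c′ j) →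
                   guess (proj₁ (clique y) i) c ≡ guess (proj₁ (clique y′) i) c′
    clique-local i {y} refl c~c′ = local (proj₁ (clique y) i) _ _ c~c′

    guessAt-local : ∀ u x y → (∀ v → StarAdj u (splitAt k v) → lookup x v ≡ lookup y v) →
                    guessAt u x ≡ guessAt u y
    guessAt-local (inj₁ i) x y x~y = clique-local i
      (tabulate-cong λ j → x~y (k ↑ʳ j) (subst (StarAdj (inj₁ i)) (sym (splitAt-↑ʳ k n j)) tt))
      λ i′ i≢i′ → trans (lookup∘tabulate _ i′)
        (trans (x~y (i′ ↑ˡ n) (subst (StarAdj (inj₁ i)) (sym (splitAt-↑ˡ k i′ n)) i≢i′))
          (sym (lookup∘tabulate _ i′)))
    guessAt-local (inj₂ j) x y x~y = cong (leafGuess j) (tabulate-cong λ i →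
      x~y (i ↑ˡ n) (subst (StarAdj (inj₂ j)) (sym (splitAt-↑ˡ k i n)) tt))

  kStar-winnable : WinnableWith (kStar k n) (suc t)
  kStar-winnable = F , wins
    where
    F : Strategies (kStar k n) (Fin Q)
    F u = record { guess = guessAt (splitAt k u) ; local = guessAt-local (splitAt k u) }

    wins : Winning (kStar k n) U F
    wins x _ with any? (λ j → leafGuess j (cliqueColors x) ≟ lookup (leafColors x) j)
    ... | yes (j , eq) = k ↑ʳ j , trans (cong (λ u → guessAt u x) (splitAt-↑ʳ k n j))
            (trans eq (lookup∘tabulate _ j))
    ... | no ∄j = let i , eq = proj₂ (clique (leafColors x)) (cliqueColors x) (λ j eq → ∄j (j , eq)) in
            i ↑ˡ n , trans (cong (λ u → guessAt u x) (splitAt-↑ˡ k i n)) (trans eq (lookup∘tabulate _ i))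

theorem13 : ∀ (k : ℕ) → 1 ≤ k →
    ∃[ N ] ∀ (n : ℕ) → n ≥ N →
    ∃[ μ ] ∃[ μₐ ]
    Isμ (kStar k n) μ × Isμₐ (complete k) μₐ ×
    μ ≥ μₐ + 1 × μₐ + 1 ≥ 2 ^ k
theorem13 k _ =
  let instance 2^k≢0 = m^n≢0 2 k
      -- The search for `μₐ` starts from the winnable size `pred (2 ^ k)`.
      t , isμₐ , 2^k-1≤t = largest (winnableOnAll≤? (complete k)) (suc k ^ k)
        (complete-winnable k (≤-reflexive (suc-pred (2 ^ k))))
        (λ _ win → <⇒≤ (winnableOnAll≤⇒< (complete k) win))
  -- Since `t` is fixed by `k` alone, this threshold is independent of `n`.
  in suc t ^ (suc t ^ k) , λ n n≥N →
    let μ , isμ , t+1≤μ = largest (winnableWith? (kStar k n)) (k + n)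
          (kStar-winnable (proj₁ isμₐ) n≥N)
          (λ _ → winnableWith⇒≤ (kStar k n))
    in μ , t , isμ , isμₐ
     , subst (_≤ μ) (+-comm 1 t) t+1≤μ
     , subst₂ _≤_ (suc-pred (2 ^ k)) (+-comm 1 t) (s≤s 2^k-1≤t)
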